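{- Let $T_{\langle3,3,3\rangle}=\sum_{t=1}^rA_t\otimes B_t\otimes C_t$ be a decomposition over $\mathbb F_2$, of arbitrary length $r$ and possibly with zero summands, that is saturated in the $A$-slot. Then: 1. At most one index $t$ has $A_t$ invertible. 2. If $r=22$ and all $A_t$ are nonzero, then the $A$-slot matrix-rank profile $(n_1,n_2,n_3)$ is either $(17,5,0)$ or $(18,3,1)$. 3. If $r=22$ (without assuming all $A_t$ nonzero), then either the $A$-slot matrix-rank profile is $(17,5,0)$ or $(18,3,1)$, or deleting a term with zero first factor $A_t$ gives a decomposition of length $21$ that is saturated in the $A$-slot.
   Context: $V=M_3(\mathbb F_2)$, with row and column indices in $\{0,1,2\}$ and matrix units $E_{ij}$. The $3\times3$ matrix multiplication tensor is $T_{\langle3,3,3\rangle}=\sum_{i,j,k=0}^2E_{ij}\otimes E_{jk}\otimes E_{ik}\in V\otimes V\otimes V$. A decomposition of length $r$ is an identity $T_{\langle3,3,3\rangle}=\sum_{t=1}^rA_t\otimes B_t\otimes C_t$ with $A_t,B_t,C_t\in V$; zero summands and repeated factors are allowed. The decomposition is saturated in the $A$-slot if $\sum_{t=1}^r\operatorname{rank}A_t=27$, where $\operatorname{rank}$ is matrix rank over $\mathbb F_2$. Its $A$-slot matrix-rank profile is $(n_1,n_2,n_3)$, where $n_j$ is the number of indices $t$ with $\operatorname{rank}A_t=j$. -}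

module Defs where

open import Algebra.Bundles using (CommutativeRing)
open import Algebra.Definitions using (Invertible)
import Algebra.Properties.CommutativeMonoid.Sum as Sum
open import Data.Bool.Base using (Bool; if_then_else_)
import Data.Bool.Properties as Bool
open import Data.Fin.Base using (Fin)
import Data.Fin.Properties as Fin
open import Data.Fin.Subset using (Subset; inside; outside; ∣_∣; _∉_; ⊥)
open import Data.Fin.Subset.Properties using (_∈?_; anySubset?; ∉⊥; ∣⊥∣≡0)
open import Data.List.Base using (List; []; _∷_; map; _++_; filter; length; allFin)
open import Data.List.Extrema.Nat using (max; max≤v⁺; xs≤max; argmax-sel)
open import Data.List.Membership.Propositional using (_∈_)
open import Data.List.Membership.Propositional.Properties
  using (∈-map⁺; ∈-map⁻; ∈-++⁺ˡ; ∈-++⁺ʳ; ∈-filter⁺; ∈-filter⁻)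
import Data.List.Relation.Unary.All as All
open import Data.List.Relation.Unary.Any using (here)
open import Data.Nat.Base using (ℕ; zero; suc; _≤_)
import Data.Nat.Properties as ℕ
open import Data.Product.Base using (_×_; _,_; ∃; proj₁; proj₂)
open import Data.Sum.Base using (inj₁; inj₂)
open import Data.Vec.Base as Vec using (Vec; lookup; tabulate; replicate)
open import Data.Vec.Functional using (Vector)
import Data.Vec.Properties as Vec
open import Function.Base using (id)
open import Relation.Binary.PropositionalEquality
  using (_≡_; refl; sym; trans)
open import Relation.Nullary.Decidable
  using (Dec; does; map′; ¬?; _×-dec_; _→-dec_; decidable-stable)

-- The field with two elements: addition is xor, multiplication is ∧.
𝔽₂ : Set
𝔽₂ = Bool

open CommutativeRing Bool.xor-∧-commutativeRing public
  using (_+_; _*_; 0#; 1#; +-commutativeMonoid)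

sum : ∀ {n} → Vector 𝔽₂ n → 𝔽₂
sum = Sum.sum +-commutativeMonoid

sumℕ : ∀ {n} → Vector ℕ n → ℕ
sumℕ = Sum.sum ℕ.+-0-commutativeMonoid

-- Square matrices, stored by rows.
Mat : ℕ → Set
Mat n = Vec (Vec 𝔽₂ n) n

infixl 9 _[_,_]
_[_,_] : ∀ {n} → Mat n → Fin n → Fin n → 𝔽₂
M [ i , j ] = lookup (lookup M i) j

mat : ∀ {n} → (Fin n → Fin n → 𝔽₂) → Mat n
mat f = tabulate λ i → tabulate λ j → f i j

δ : ∀ {n} → Fin n → Fin n → 𝔽₂
δ i j = if does (i Fin.≟ j) then 1# else 0#

0ᴹ : ∀ {n} → Mat n
0ᴹ = mat λ _ _ → 0#

1ᴹ : ∀ {n} → Mat n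
1ᴹ = mat δ

_*ᴹ_ : ∀ {n} → Mat n → Mat n → Mat n
M *ᴹ N = mat λ i k → sum λ j → M [ i , j ] * N [ j , k ]

E : ∀ {n} → Fin n → Fin n → Mat n
E i j = mat λ k l → δ i k * δ j l

IsInvertible : ∀ {n} → Mat n → Set
IsInvertible = Invertible _≡_ 1ᴹ _*ᴹ_

-- The columns of M with index in S are linearly independent; S is a set of
-- indices, and c a coefficient vector vanishing off S.
ColumnsIndependent : ∀ {n} → Mat n → Subset n → Set
ColumnsIndependent {n} M S =
  (c : Vec 𝔽₂ n) →
  (∀ j → j ∉ S → lookup c j ≡ 0#) →
  (∀ i → sum (λ j → lookup c j * M [ i , j ]) ≡ 0#) →
  c ≡ replicate n 0#

columnsIndependent? : ∀ {n} (M : Mat n) S → Dec (ColumnsIndependent M S)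
columnsIndependent? {n} M S =
  map′ (λ ¬bad c out rel →
         decidable-stable (c ≟ᵛ replicate n 0#) λ c≢0 → ¬bad (c , out , rel , c≢0))
       (λ indep (c , out , rel , c≢0) → c≢0 (indep c out rel))
       (¬? (anySubset? λ c →
         Fin.all? (λ j → ¬? (j ∈? S) →-dec (lookup c j Bool.≟ 0#))
         ×-dec Fin.all? (λ i → sum (λ j → lookup c j * M [ i , j ]) Bool.≟ 0#)
         ×-dec ¬? (c ≟ᵛ replicate n 0#)))
  where _≟ᵛ_ = Vec.≡-dec {n = n} Bool._≟_

subsets : ∀ n → List (Subset n)
subsets zero    = Vec.[] ∷ []
subsets (suc n) = map (outside Vec.∷_) (subsets n) ++ map (inside Vec.∷_) (subsets n)

-- The largest number of linearly independent columns, found by enumeration;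
-- rank-upper and rank-attained characterise it without the enumeration.
rank : ∀ {n} → Mat n → ℕ
rank {n} M = max 0 (map ∣_∣ (filter (columnsIndependent? M) (subsets n)))

∈-subsets : ∀ {n} (S : Subset n) → S ∈ subsets n
∈-subsets Vec.[]            = here refl
∈-subsets (outside Vec.∷ S) = ∈-++⁺ˡ (∈-map⁺ _ (∈-subsets S))
∈-subsets (inside  Vec.∷ S) =
  ∈-++⁺ʳ (map (outside Vec.∷_) (subsets _)) (∈-map⁺ _ (∈-subsets S))

rank-upper : ∀ {n} (M : Mat n) S → ColumnsIndependent M S → ∣ S ∣ ≤ rank M
rank-upper M S indep =
  All.lookup (xs≤max 0 _)
    (∈-map⁺ ∣_∣ (∈-filter⁺ (columnsIndependent? M) (∈-subsets S) indep))

rank-attained : ∀ {n} (M : Mat n) → ∃ λ S → ColumnsIndependent M S × ∣ S ∣ ≡ rank M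
rank-attained {n} M
  with argmax-sel id 0 (map ∣_∣ (filter (columnsIndependent? M) (subsets n)))
... | inj₁ rank≡0 = ⊥ , indep , trans (∣⊥∣≡0 n) (sym rank≡0)
  where
  indep : ColumnsIndependent M ⊥
  indep c out _ = trans (sym (Vec.tabulate∘lookup c))
    (trans (Vec.tabulate-cong λ j → trans (out j ∉⊥)
                                          (sym (Vec.lookup-replicate j 0#)))
           (Vec.tabulate∘lookup (replicate n 0#)))
... | inj₂ rank∈ =
  let S , S∈ , rank≡∣S∣ = ∈-map⁻ ∣_∣ rank∈
  in  S , proj₂ (∈-filter⁻ (columnsIndependent? M) {xs = subsets n} S∈) , sym rank≡∣S∣

V : Set
V = Mat 3

-- A tensor is given by its coordinates in the basis E i j ⊗ E k l ⊗ E m n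
-- of V ⊗ V ⊗ V, so equality of tensors is pointwise.
Tensor : Set
Tensor = (i j k l m n : Fin 3) → 𝔽₂

infix 4 _≈_
_≈_ : Tensor → Tensor → Set
T ≈ U = ∀ i j k l m n → T i j k l m n ≡ U i j k l m n

infix 8 _⊗_⊗_
_⊗_⊗_ : V → V → V → Tensor
(A ⊗ B ⊗ C) i j k l m n = A [ i , j ] * B [ k , l ] * C [ m , n ]

sumᵀ : ∀ {r} → Vector Tensor r → Tensor
sumᵀ T i j k l m n = sum λ t → T t i j k l m n

T⟨3,3,3⟩ : Tensor
T⟨3,3,3⟩ = sumᵀ λ i → sumᵀ λ j → sumᵀ λ k → E i j ⊗ E j k ⊗ E i k

IsDecomposition : ∀ {r} → (A B C : Vector V r) → Set
IsDecomposition A B C = T⟨3,3,3⟩ ≈ sumᵀ λ t → A t ⊗ B t ⊗ C t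

-- Saturation and the rank profile of a slot depend only on the factors in
-- that slot.
Saturated : ∀ {r} → Vector V r → Set
Saturated A = sumℕ (λ t → rank (A t)) ≡ 27

countRank : ∀ {r} → ℕ → Vector V r → ℕ
countRank {r} j A = length (filter (λ t → rank (A t) ℕ.≟ j) (allFin r))

profile : ∀ {r} → Vector V r → ℕ × ℕ × ℕ
profile A = countRank 1 A , countRank 2 A , countRank 3 A

{-# OPTIONS --safe #-}
module Submission where

-- Factor A t = L t · R t through its rank, and group the coordinates of the
-- tensor as (i , j , k) against (i′ , j′ , k′), where A has indices i j′, B has
-- j k and C has i′ k′.  The matrix multiplication tensor becomes the 27 × 27
-- identity, and the decomposition writes it as a product X · Y with Σ rank (A t)
-- as inner dimension.  Saturation makes X and Y square, so Y · X is the identity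
-- as well; its blocks say that R t · B s · C tᵀ · L s is the identity for s = t
-- and zero otherwise.  If A s and A t are invertible with s ≠ t, then
-- B s · C tᵀ = 0 although B s is invertible and C t is not zero.  Likewise A t of
-- rank 3 has the inverse B t · C tᵀ, so there is at most one such t, and counting
-- determines the profile.

open import Defs
open import Algebra.Bundles using (CommutativeRing)
import Algebra.Properties.CommutativeMonoid.Sum as Sum
import Algebra.Properties.Semiring.Sum as SemiringSum
open import Data.Bool.Base using (true; false; if_then_else_)
import Data.Bool.Properties as Bool
open import Data.Fin.Base
  using (Fin; zero; suc; _↑ˡ_; _↑ʳ_; splitAt; punchOut; combine; funToFin; finToFun)
import Data.Fin.Properties as Fin
open import Data.Fin.Subset using (Subset; inside; outside; ∣_∣; _∉_; _∪_; ⁅_⁆)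
open import Data.Fin.Subset.Properties
  using (_∈?_; anySubset?; ∣p∣≤n; p⊂q⇒∣p∣<∣q∣; p⊆p∪q; x∈p∪q⁺; x∈p∪q⁻; x∈⁅x⁆;
         x≢y⇒x∉⁅y⁆; drop-there)
open import Data.List.Base using (List; []; _∷_; filter; length; allFin; map; tabulate)
open import Data.List.Properties using (length-tabulate; map-tabulate)
open import Data.List.Relation.Unary.All as All using (All; []; _∷_)
import Data.List.Relation.Unary.All.Properties as All
open import Data.List.Relation.Unary.AllPairs using ([]; _∷_)
open import Data.List.Relation.Unary.Unique.Propositional using (Unique)
import Data.List.Relation.Unary.Unique.Propositional.Properties as Unique
open import Data.Nat.Base as ℕ using (ℕ; zero; suc; _≤_; _<_; z≤n; s≤s; _^_)
import Data.Nat.ListAction as ListAction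
import Data.Nat.Properties as ℕ
open import Data.Nat.Solver using (module +-*-Solver)
open import Data.Product.Base using (Σ; _×_; _,_; ∃; proj₁; proj₂)
open import Data.Sum.Base using (_⊎_; inj₁; inj₂; [_,_]′)
open import Data.Vec.Base as Vec using (Vec; lookup)
import Data.Vec.Properties as Vec
open import Data.Vec.Functional using (Vector; removeAt)
open import Function.Base using (_∘_; id)
open import Function.Bundles using (module Inverse)
open import Function.Definitions using (Injective)
open import Relation.Binary.Bundles using (Setoid)
import Relation.Binary.Reasoning.Setoid as ≈-Reasoning
open import Relation.Binary.PropositionalEquality
  using (_≡_; _≢_; _≗_; refl; sym; trans; cong; cong₂; subst; module ≡-Reasoning)
open import Relation.Nullary.Decidable
  using (Dec; yes; no; from-yes; _×-dec_; ¬?; _→-dec_; dec-true; dec-false)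
open import Relation.Nullary.Negation using (¬_; contradiction)

open CommutativeRing Bool.xor-∧-commutativeRing
  using (semiring; *-assoc; *-comm; zeroʳ; +-identityʳ; +-assoc; distribʳ)
open SemiringSum semiring
  using (sum-cong-≗; ∑-comm; ∑-distrib-+; sum-replicate-zero;
         *-distribˡ-sum; *-distribʳ-sum; sum-remove)

module ℕSum = Sum ℕ.+-0-commutativeMonoid

private
  variable
    m n p q r : ℕ

-- Finite sums over `𝔽₂` and the Kronecker delta.

sum-cong₂ : {k : Vector ℕ m} {f g : ∀ i → Fin (k i) → 𝔽₂} → (∀ i j → f i j ≡ g i j) →
            sum (λ i → sum (f i)) ≡ sum (λ i → sum (g i))
sum-cong₂ f≡g = sum-cong-≗ λ i → sum-cong-≗ (f≡g i)

sum-zero : (f : Vector 𝔽₂ n) → (∀ i → f i ≡ 0#) → sum f ≡ 0#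
sum-zero {n} f f≡0 = trans (sum-cong-≗ f≡0) (sum-replicate-zero n)

sum-δ : (i : Fin n) (f : Vector 𝔽₂ n) → sum (λ j → δ i j * f j) ≡ f i
sum-δ zero    f = trans
  (cong (f zero +_) (sum-zero (λ j → 0# * f (suc j)) λ _ → refl))
  (+-identityʳ (f zero))
sum-δ (suc i) f = sum-δ i (f ∘ suc)

sum-++ : ∀ m {n} (f : Vector 𝔽₂ (m ℕ.+ n)) →
         sum f ≡ sum (λ i → f (i ↑ˡ n)) + sum (λ i → f (m ↑ʳ i))
sum-++ zero    f = refl
sum-++ (suc m) f = trans (cong (f zero +_) (sum-++ m (f ∘ suc))) (sym (+-assoc (f zero) _ _))

δ-refl : (i : Fin n) → δ i i ≡ 1#
δ-refl i = cong (if_then 1# else 0#) (dec-true (i Fin.≟ i) refl)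

δ-distinct : {i j : Fin n} → i ≢ j → δ i j ≡ 0#
δ-distinct {i = i} {j} i≢j = cong (if_then 1# else 0#) (dec-false (i Fin.≟ j) i≢j)

δ-sym : (i j : Fin n) → δ i j ≡ δ j i
δ-sym i j with i Fin.≟ j
... | yes refl = sym (δ-refl i)
... | no  i≢j  = sym (δ-distinct (i≢j ∘ sym))

δ-injective : {f : Fin m → Fin n} → Injective _≡_ _≡_ f → ∀ i j → δ (f i) (f j) ≡ δ i j
δ-injective {f = f} f-inj i j with i Fin.≟ j
... | yes refl = δ-refl (f i)
... | no  i≢j  = δ-distinct (i≢j ∘ f-inj)

-- Matrices as functions

Matrix : ℕ → ℕ → Set
Matrix m n = Fin m → Fin n → 𝔽₂

infix  4 _≐_
infixr 7 _⊡_

_≐_ : Matrix m n → Matrix m n → Set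
M ≐ N = ∀ i j → M i j ≡ N i j

matrixSetoid : ℕ → ℕ → Setoid _ _
matrixSetoid m n = record
  { Carrier       = Matrix m n
  ; _≈_           = _≐_
  ; isEquivalence = record
    { refl  = λ _ _ → refl
    ; sym   = λ M≐N i j → sym (M≐N i j)
    ; trans = λ M≐N N≐P i j → trans (M≐N i j) (N≐P i j)
    }
  }

_·_ : Matrix m n → Vector 𝔽₂ n → Vector 𝔽₂ m
(M · v) i = sum λ j → M i j * v j

_⊡_ : Matrix m n → Matrix n p → Matrix m p
(M ⊡ N) i k = (M · λ j → N j k) i

𝟘 : Matrix m n
𝟘 _ _ = 0#

_ᵀ : Matrix m n → Matrix n m
(M ᵀ) i j = M j i

entries : Mat n → Matrix n n
entries M i j = M [ i , j ]

·-congʳ : (M : Matrix m n) {v w : Vector 𝔽₂ n} → v ≗ w → M · v ≗ M · w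
·-congʳ M v≗w i = sum-cong-≗ λ j → cong (M i j *_) (v≗w j)

·-assoc : (M : Matrix m n) (N : Matrix n p) (v : Vector 𝔽₂ p) → (M ⊡ N) · v ≗ M · (N · v)
·-assoc M N v i = begin
  sum (λ k → sum (λ j → M i j * N j k) * v k)
    ≡⟨ sum-cong-≗ (λ k → *-distribʳ-sum (v k) (λ j → M i j * N j k)) ⟩
  sum (λ k → sum (λ j → M i j * N j k * v k))     ≡⟨ ∑-comm (λ k j → M i j * N j k * v k) ⟩
  sum (λ j → sum (λ k → M i j * N j k * v k))
    ≡⟨ sum-cong₂ (λ j k → *-assoc (M i j) (N j k) (v k)) ⟩
  sum (λ j → sum (λ k → M i j * (N j k * v k)))
    ≡⟨ sum-cong-≗ (λ j → sym (*-distribˡ-sum (M i j) (λ k → N j k * v k))) ⟩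
  sum (λ j → M i j * sum (λ k → N j k * v k))     ∎
  where open ≡-Reasoning

⊡-congʳ : (M : Matrix m n) {N P : Matrix n p} → N ≐ P → M ⊡ N ≐ M ⊡ P
⊡-congʳ M N≐P i k = ·-congʳ M (λ j → N≐P j k) i

⊡-congˡ : {M N : Matrix m n} (P : Matrix n p) → M ≐ N → M ⊡ P ≐ N ⊡ P
⊡-congˡ P M≐N i k = sum-cong-≗ λ j → cong (_* P j k) (M≐N i j)

⊡-assoc : (M : Matrix m n) (N : Matrix n p) (P : Matrix p q) → (M ⊡ N) ⊡ P ≐ M ⊡ N ⊡ P
⊡-assoc M N P i l = ·-assoc M N (λ k → P k l) i

⊡-identityˡ : (M : Matrix m n) → δ ⊡ M ≐ M
⊡-identityˡ M i k = sum-δ i λ j → M j k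

⊡-identityʳ : (M : Matrix m n) → M ⊡ δ ≐ M
⊡-identityʳ M i k = trans
  (sum-cong-≗ λ j → trans (*-comm (M i j) (δ j k)) (cong (_* M i j) (δ-sym j k)))
  (sum-δ k (M i))

⊡-zeroˡ : (M : Matrix n p) → 𝟘 {m} ⊡ M ≐ 𝟘
⊡-zeroˡ M i k = sum-zero (λ j → 0# * M j k) λ _ → refl

⊡-zeroʳ : (M : Matrix m n) → M ⊡ 𝟘 {n} {p} ≐ 𝟘
⊡-zeroʳ M i k = sum-zero (λ j → M i j * 0#) λ j → zeroʳ (M i j)

-- One-sided inverses

-- `g` is injective because `f` undoes it. A value `y` missed by `g` could be punched out, leaving
-- an injection from `Fin (suc n)` into `Fin n`; so `g` hits every `y`, and there the equation
-- follows from `fg≡id`.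
Fin-inverse-comm : (f g : Fin n → Fin n) → (∀ x → f (g x) ≡ x) → ∀ y → g (f y) ≡ y
Fin-inverse-comm {suc n} f g fg≡id y with Fin.any? (λ x → g x Fin.≟ y)
... | yes (x , refl) = cong g (fg≡id x)
... | no  y∉g        = contradiction (Fin.injective⇒≤ punched-injective) ℕ.1+n≰n
  where
  y≢g : ∀ x → y ≢ g x
  y≢g x y≡gx = y∉g (x , sym y≡gx)
  punched-injective : Injective _≡_ _≡_ (λ x → punchOut (y≢g x))
  punched-injective {x} {x′} eq =
    trans (sym (fg≡id x)) (trans (cong f (Fin.punchOut-injective (y≢g x) (y≢g x′) eq)) (fg≡id x′))

open Inverse Fin.2↔Bool using ()
  renaming ( to to toBool; from to fromBool
           ; strictlyInverseˡ to toBool∘fromBool; strictlyInverseʳ to fromBool∘toBool)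

-- Numbering the vectors of length `n` turns a square matrix into a self-map of `Fin (2 ^ n)`, to
-- which `Fin-inverse-comm` applies.
encode : Vector 𝔽₂ n → Fin (2 ^ n)
encode v = funToFin (fromBool ∘ v)

decode : Fin (2 ^ n) → Vector 𝔽₂ n
decode {n} x i = toBool (finToFun {2} {n} x i)

decode-encode : (v : Vector 𝔽₂ n) → decode (encode v) ≗ v
decode-encode v i =
  trans (cong toBool (Fin.finToFun-funToFin (fromBool ∘ v) i)) (toBool∘fromBool (v i))

funToFin-cong : {f g : Fin m → Fin n} → f ≗ g → funToFin f ≡ funToFin g
funToFin-cong {zero}  f≗g = refl
funToFin-cong {suc m} f≗g = cong₂ combine (f≗g zero) (funToFin-cong (f≗g ∘ suc))

encode-cong : {v w : Vector 𝔽₂ n} → v ≗ w → encode v ≡ encode w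
encode-cong v≗w = funToFin-cong λ i → cong fromBool (v≗w i)

encode-decode : (x : Fin (2 ^ n)) → encode (decode {n} x) ≡ x
encode-decode {n} x = trans
  (funToFin-cong λ i → fromBool∘toBool (finToFun {2} {n} x i))
  (Fin.funToFin-finToFin {n} {2} x)

-- The pigeonhole principle on the finite set 𝔽₂ⁿ replaces elimination.
⊡-inverse-comm : (X Y : Matrix n n) → X ⊡ Y ≐ δ → Y ⊡ X ≐ δ
⊡-inverse-comm {n} X Y XY≐δ i j = begin
  -- Column `j` of `Y ⊡ X` is its action on the basis vector `λ k → δ k j`.
  (Y ⊡ X) i j                ≡⟨ ⊡-congʳ Y (λ k l → sym (⊡-identityʳ X k l)) i j ⟩
  (Y · (X · λ k → δ k j)) i  ≡⟨ YX·v≗v (λ k → δ k j) i ⟩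
  δ i j                      ∎
  where
  open ≡-Reasoning
  act : Matrix n n → Fin (2 ^ n) → Fin (2 ^ n)
  act M x = encode (M · decode x)

  act-encode : ∀ M v → act M (encode v) ≡ encode (M · v)
  act-encode M v = encode-cong (·-congʳ M (decode-encode v))

  X∘Y : ∀ x → act X (act Y x) ≡ x
  X∘Y x = begin
    act X (act Y x)                ≡⟨ act-encode X (Y · decode x) ⟩
    encode (X · (Y · decode x))    ≡⟨ encode-cong (λ i → trans (sym (·-assoc X Y (decode x) i))
                                       (trans (sum-cong-≗ λ j → cong (_* decode {n} x j) (XY≐δ i j))
                                              (sum-δ i (decode x)))) ⟩
    encode (decode {n} x)          ≡⟨ encode-decode {n} x ⟩
    x                              ∎

  YX·v≗v : ∀ v → Y · (X · v) ≗ v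
  YX·v≗v v i = begin
    (Y · (X · v)) i                        ≡⟨ sym (decode-encode (Y · (X · v)) i) ⟩
    decode (encode (Y · (X · v))) i
      ≡⟨ cong (λ x → decode x i) (sym (trans (cong (act Y) (act-encode X v))
                                                (act-encode Y (X · v)))) ⟩
    decode (act Y (act X (encode v))) i
      ≡⟨ cong (λ x → decode x i) (Fin-inverse-comm (act X) (act Y) X∘Y (encode v)) ⟩
    decode (encode v) i                    ≡⟨ decode-encode v i ⟩
    v i                                    ∎

-- Rank factorisation

-- The increasing enumeration of `S`.
elements : (S : Subset n) → Fin ∣ S ∣ → Fin n
elements (inside  Vec.∷ S) zero    = zero
elements (inside  Vec.∷ S) (suc a) = suc (elements S a)
elements (outside Vec.∷ S) a       = suc (elements S a)

sum-elements : (S : Subset n) (f : Vector 𝔽₂ n) → (∀ j → j ∉ S → f j ≡ 0#) →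
               sum f ≡ sum (f ∘ elements S)
sum-elements Vec.[] f out = refl
sum-elements (inside Vec.∷ S) f out =
  cong (f zero +_) (sum-elements S (f ∘ suc) λ j j∉S → out (suc j) (j∉S ∘ drop-there))
sum-elements (outside Vec.∷ S) f out = begin
  f zero + sum (f ∘ suc)  ≡⟨ cong (_+ sum (f ∘ suc)) (out zero λ ()) ⟩
  sum (f ∘ suc)           ≡⟨ sum-elements S (f ∘ suc) (λ j j∉S → out (suc j) (j∉S ∘ drop-there)) ⟩
  sum (f ∘ suc ∘ elements S) ∎
  where open ≡-Reasoning

-- The coefficients form a `Vec 𝔽₂ n`, which is the same type as `Subset n`, so `anySubset?` can
-- search through them.
ColumnSpanned : Mat n → Subset n → Fin n → Set
ColumnSpanned {n} M S j = ∃ λ (c : Vec 𝔽₂ n) →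
  (∀ k → k ∉ S → lookup c k ≡ 0#) × (∀ i → sum (λ k → lookup c k * M [ i , k ]) ≡ M [ i , j ])

columnSpanned? : (M : Mat n) (S : Subset n) (j : Fin n) → Dec (ColumnSpanned M S j)
columnSpanned? M S j = anySubset? λ c →
  Fin.all? (λ k → ¬? (k ∈? S) →-dec (lookup c k Bool.≟ 0#))
  ×-dec Fin.all? (λ i → sum (λ k → lookup c k * M [ i , k ]) Bool.≟ M [ i , j ])

-- A column outside the span of a largest independent set could be added to it.
columnSpanned : (M : Mat n) (S : Subset n) → ColumnsIndependent M S → ∣ S ∣ ≡ rank M →
                ∀ j → ColumnSpanned M S j
columnSpanned {n} M S indep ∣S∣≡rank j with columnSpanned? M S j
... | yes spanned  = spanned
... | no  ¬spanned = contradiction larger (ℕ.<⇒≱ smaller)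
  where
  open ≡-Reasoning
  S⁺ : Subset n
  S⁺ = S ∪ ⁅ j ⁆

  k∉S⁺ : ∀ {k} → k ∉ S → k ≢ j → k ∉ S⁺
  k∉S⁺ k∉S k≢j k∈S⁺ = [ k∉S , x≢y⇒x∉⁅y⁆ k≢j ]′ (x∈p∪q⁻ S ⁅ j ⁆ k∈S⁺)

  spannedBy : (c : Vector 𝔽₂ n) → (∀ k → k ∉ S → c k ≡ 0#) →
              (∀ i → sum (λ k → c k * M [ i , k ]) ≡ M [ i , j ]) → ColumnSpanned M S j
  spannedBy c out rel = Vec.tabulate c
    , (λ k k∉S → trans (Vec.lookup∘tabulate c k) (out k k∉S))
    , (λ i → trans (sum-cong-≗ λ k → cong (_* M [ i , k ]) (Vec.lookup∘tabulate c k)) (rel i))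

  j∉S : j ∉ S
  -- Otherwise column `j` would be spanned by itself, with coefficient vector `δ j`.
  j∉S j∈S = ¬spanned (spannedBy (δ j)
    (λ k k∉S → δ-distinct {i = j} {k} λ { refl → k∉S j∈S }) (λ i → sum-δ j λ k → M [ i , k ]))

  -- If the coefficient at j is 1, adding 1 to it moves column j to the other side.
  indep⁺ : ColumnsIndependent M S⁺
  indep⁺ c out rel with lookup c j in cⱼ
  ... | false = indep c outS rel
    where
    outS : ∀ k → k ∉ S → lookup c k ≡ 0#
    outS k k∉S with k Fin.≟ j
    ... | yes refl = cⱼ
    ... | no  k≢j  = out k (k∉S⁺ k∉S k≢j)
  ... | true  = contradiction (spannedBy (λ k → lookup c k + δ j k) outS relS) ¬spanned
    where
    outS : ∀ k → k ∉ S → lookup c k + δ j k ≡ 0#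
    outS k k∉S with k Fin.≟ j
    ... | yes refl = cong₂ _+_ cⱼ (δ-refl k)
    ... | no  k≢j  = cong₂ _+_ (out k (k∉S⁺ k∉S k≢j)) (δ-distinct (k≢j ∘ sym))
    relS : ∀ i → sum (λ k → (lookup c k + δ j k) * M [ i , k ]) ≡ M [ i , j ]
    relS i = begin
      sum (λ k → (lookup c k + δ j k) * M [ i , k ])
        ≡⟨ sum-cong-≗ (λ k → distribʳ (M [ i , k ]) (lookup c k) (δ j k)) ⟩
      sum (λ k → lookup c k * M [ i , k ] + δ j k * M [ i , k ])
        ≡⟨ ∑-distrib-+ (λ k → lookup c k * M [ i , k ]) (λ k → δ j k * M [ i , k ]) ⟩
      sum (λ k → lookup c k * M [ i , k ]) + sum (λ k → δ j k * M [ i , k ])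
        ≡⟨ cong₂ _+_ (rel i) (sum-δ j λ k → M [ i , k ]) ⟩
      M [ i , j ] ∎

  larger : ∣ S⁺ ∣ ≤ ∣ S ∣
  larger = subst (∣ S⁺ ∣ ≤_) (sym ∣S∣≡rank) (rank-upper M S⁺ indep⁺)

  smaller : ∣ S ∣ < ∣ S⁺ ∣
  smaller = p⊂q⇒∣p∣<∣q∣ (p⊆p∪q ⁅ j ⁆ , j , x∈p∪q⁺ (inj₂ (x∈⁅x⁆ j)) , j∉S)

-- The inner dimension is a parameter, so it can be transported along equations: from the size of a
-- column set to the rank, or from the rank to 0 or `n`.
record Factorisation (M : Mat n) (k : ℕ) : Set where
  constructor factorisation
  field
    left    : Matrix n k
    right   : Matrix k n
    factors : entries M ≐ left ⊡ right

-- A largest independent set of columns forms the left factor; column `j` of the right factor holds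
-- the coefficients that express column `j` of `M` in them.
rank-factorisation : (M : Mat n) → Factorisation M (rank M)
rank-factorisation {n} M with S , indep , ∣S∣≡rank ← rank-attained M =
  subst (Factorisation M) ∣S∣≡rank record
    { left    = λ i a → M [ i , elements S a ]
    ; right   = λ a j → lookup (c j) (elements S a)
    ; factors = λ i j → begin
        M [ i , j ]
          ≡⟨ proj₂ (proj₂ (span j)) i ⟨
        sum (λ k → lookup (c j) k * M [ i , k ])
          ≡⟨ sum-cong-≗ (λ k → *-comm (lookup (c j) k) (M [ i , k ])) ⟩
        sum (λ k → M [ i , k ] * lookup (c j) k)
          ≡⟨ sum-elements S (λ k → M [ i , k ] * lookup (c j) k)
               (λ k k∉S → trans (cong (M [ i , k ] *_) (proj₁ (proj₂ (span j)) k k∉S))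
                                (zeroʳ (M [ i , k ]))) ⟩
        sum (λ a → M [ i , elements S a ] * lookup (c j) (elements S a)) ∎
    }
  where
  open ≡-Reasoning
  span : ∀ j → ColumnSpanned M S j
  span = columnSpanned M S indep ∣S∣≡rank
  c : Fin n → Vec 𝔽₂ n
  c j = proj₁ (span j)

rank≤n : (M : Mat n) → rank M ≤ n
rank≤n M with S , _ , ∣S∣≡rank ← rank-attained M = subst (_≤ _) ∣S∣≡rank (∣p∣≤n S)

≡-entries : {M N : Mat n} → entries M ≐ entries N → M ≡ N
≡-entries {M = M} {N} eq = ext λ i → ext (eq i)
  where
  ext : ∀ {A : Set} {n} {v w : Vec A n} → lookup v ≗ lookup w → v ≡ w
  ext {v = v} {w} v≗w = trans (sym (Vec.tabulate∘lookup v))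
                              (trans (Vec.tabulate-cong v≗w) (Vec.tabulate∘lookup w))

entries-mat : (f : Matrix n n) → entries (mat f) ≐ f
entries-mat f i j = trans
  (cong (λ row → lookup row j) (Vec.lookup∘tabulate (λ i → Vec.tabulate (f i)) i))
  (Vec.lookup∘tabulate (f i) j)

-- With inner dimension 0 every entry of the product is an empty sum.
rank≡0⇒≡0ᴹ : (M : Mat n) → rank M ≡ 0 → M ≡ 0ᴹ
rank≡0⇒≡0ᴹ M rank≡0 = ≡-entries λ i j → trans
  (Factorisation.factors (subst (Factorisation M) rank≡0 (rank-factorisation M)) i j)
  (sym (entries-mat 𝟘 i j))

-- Sums over disjoint unions

Index : Vector ℕ r → Set
Index {r} k = Σ (Fin r) (Fin ∘ k)

-- `Fin (sumℕ k)` is the disjoint union of the `Fin (k t)`. The case distinction is a separate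
-- function, so equations about `splitAt` can be applied under it by `cong`.
split  : (k : Vector ℕ r) → Fin (sumℕ k) → Index k
split⊎ : (k : Vector ℕ (suc r)) → Fin (k zero) ⊎ Fin (sumℕ (k ∘ suc)) → Index k

split {suc r} k x = split⊎ k (splitAt (k zero) x)

split⊎ k (inj₁ a) = zero , a
split⊎ k (inj₂ y) = let t , a = split (k ∘ suc) y in suc t , a

merge : (k : Vector ℕ r) (t : Fin r) → Fin (k t) → Fin (sumℕ k)
merge k zero    a = a ↑ˡ sumℕ (k ∘ suc)
merge k (suc t) a = k zero ↑ʳ merge (k ∘ suc) t a

split-merge : (k : Vector ℕ r) (t : Fin r) (a : Fin (k t)) → split k (merge k t a) ≡ (t , a)
split-merge k zero    a rewrite Fin.splitAt-↑ˡ (k zero) a (sumℕ (k ∘ suc)) = refl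
split-merge k (suc t) a
  rewrite Fin.splitAt-↑ʳ (k zero) (sumℕ (k ∘ suc)) (merge (k ∘ suc) t a)
        | split-merge (k ∘ suc) t a = refl

merge-injective : (k : Vector ℕ r) (s t : Fin r) {a : Fin (k s)} {b : Fin (k t)} →
                  merge k s a ≡ merge k t b → _≡_ {A = Index k} (s , a) (t , b)
merge-injective k s t {a} {b} eq =
  trans (sym (split-merge k s a)) (trans (cong (split k) eq) (split-merge k t b))

sum-split : (k : Vector ℕ r) (f : Index k → 𝔽₂) →
            sum (f ∘ split k) ≡ sum λ t → sum λ a → f (t , a)
sum-split {zero}  k f = refl
sum-split {suc r} k f = begin
  sum (f ∘ split k)
    ≡⟨ sum-++ (k zero) (f ∘ split k) ⟩
  sum (λ a → f (split k (a ↑ˡ sumℕ (k ∘ suc)))) + sum (λ y → f (split k (k zero ↑ʳ y)))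
    ≡⟨ cong₂ _+_
         (sum-cong-≗ λ a → cong (f ∘ split⊎ k) (Fin.splitAt-↑ˡ (k zero) a (sumℕ (k ∘ suc))))
         (sum-cong-≗ λ y → cong (f ∘ split⊎ k) (Fin.splitAt-↑ʳ (k zero) (sumℕ (k ∘ suc)) y)) ⟩
  sum (λ a → f (zero , a)) + sum (λ y → let t , a = split (k ∘ suc) y in f (suc t , a))
    ≡⟨ cong (sum (λ a → f (zero , a)) +_)
            (sum-split (k ∘ suc) λ (t , a) → f (suc t , a)) ⟩
  sum (λ t → sum λ a → f (t , a)) ∎
  where open ≡-Reasoning

-- The matrix multiplication tensor as a 27 × 27 identity matrix.

Cell : Set
Cell = Fin 3 × Fin 3 × Fin 3

-- Both 27 = 9 + 9 + 9 and 9 = 3 + 3 + 3 hold by computation, so `sum-split` also handles sums over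
-- cells.
cell : Fin 27 → Cell
cell x = let i , y = split {3} (λ _ → 9) x
             j , k = split {3} (λ _ → 3) y
         in i , j , k

sum-cell : (f : Cell → 𝔽₂) → sum (f ∘ cell) ≡ sum λ i → sum λ j → sum λ k → f (i , j , k)
sum-cell f = trans
  (sum-split (λ _ → 9) λ (i , y) → let j , k = split {3} (λ _ → 3) y in f (i , j , k))
  (sum-cong-≗ λ i → sum-split (λ _ → 3) λ (j , k) → f (i , j , k))

flatten : Tensor → Matrix 27 27
flatten T x y = let i , j , k = cell x ; i′ , j′ , k′ = cell y in T i j′ j k i′ k′

-- The coordinate at `E i j′ ⊗ E j k ⊗ E i′ k′` is 1 exactly when `i ≡ i′`, `j ≡ j′` and `k ≡ k′`.
-- All 729 entries are checked by evaluation.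
flatten-T⟨3,3,3⟩ : flatten T⟨3,3,3⟩ ≐ δ
flatten-T⟨3,3,3⟩ = from-yes
  (Fin.all? λ x → Fin.all? λ y → flatten T⟨3,3,3⟩ x y Bool.≟ δ x y)

-- Cancellation and invertibility.

-- The inner dimension `sumℕ ranks` equals 27 only by the saturation hypothesis, not by computation;
-- with variables for both sizes that equation can be matched with `refl`.
⊡-inverse-comm-≡ : m ≡ n → (X : Matrix m n) (Y : Matrix n m) → X ⊡ Y ≐ δ → Y ⊡ X ≐ δ
⊡-inverse-comm-≡ refl = ⊡-inverse-comm

⊡-cancelˡ : (Q M : Matrix n n) (H K : Matrix n p) → Q ⊡ M ≐ δ → M ⊡ H ≐ M ⊡ K → H ≐ K
⊡-cancelˡ {n} {p} Q M H K QM≐δ MH≐MK = begin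
  H            ≈⟨ ⊡-identityˡ H ⟨
  δ ⊡ H        ≈⟨ ⊡-congˡ H QM≐δ ⟨
  (Q ⊡ M) ⊡ H  ≈⟨ ⊡-assoc Q M H ⟩
  Q ⊡ M ⊡ H    ≈⟨ ⊡-congʳ Q MH≐MK ⟩
  Q ⊡ M ⊡ K    ≈⟨ ⊡-assoc Q M K ⟨
  (Q ⊡ M) ⊡ K  ≈⟨ ⊡-congˡ K QM≐δ ⟩
  δ ⊡ K        ≈⟨ ⊡-identityˡ K ⟩
  K            ∎
  where open ≈-Reasoning (matrixSetoid n p)

⊡-cancelʳ : (P M : Matrix n n) (H K : Matrix m n) → M ⊡ P ≐ δ → H ⊡ M ≐ K ⊡ M → H ≐ K
⊡-cancelʳ {n} {m} P M H K MP≐δ HM≐KM = begin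
  H            ≈⟨ ⊡-identityʳ H ⟨
  H ⊡ δ        ≈⟨ ⊡-congʳ H MP≐δ ⟨
  H ⊡ M ⊡ P    ≈⟨ ⊡-assoc H M P ⟨
  (H ⊡ M) ⊡ P  ≈⟨ ⊡-congˡ P HM≐KM ⟩
  (K ⊡ M) ⊡ P  ≈⟨ ⊡-assoc K M P ⟩
  K ⊡ M ⊡ P    ≈⟨ ⊡-congʳ K MP≐δ ⟩
  K ⊡ δ        ≈⟨ ⊡-identityʳ K ⟩
  K            ∎
  where open ≈-Reasoning (matrixSetoid m n)

entries-product : (M N : Mat n) → M *ᴹ N ≡ 1ᴹ → entries M ⊡ entries N ≐ δ
entries-product M N MN≡1 i j = trans
  (sym (entries-mat (entries M ⊡ entries N) i j))
  (trans (cong (_[ i , j ]) MN≡1) (entries-mat δ i j))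

entries-inverseˡ : {M : Mat n} (M⁻¹ : IsInvertible M) → entries (proj₁ M⁻¹) ⊡ entries M ≐ δ
entries-inverseˡ {M = M} (N , NM≡1 , _) = entries-product N M NM≡1

entries-inverseʳ : {M : Mat n} (M⁻¹ : IsInvertible M) → entries M ⊡ entries (proj₁ M⁻¹) ≐ δ
entries-inverseʳ {M = M} (N , _ , MN≡1) = entries-product M N MN≡1

invertible : (M : Mat n) (N : Matrix n n) → N ⊡ entries M ≐ δ → IsInvertible M
invertible {n} M N NM≐δ = mat N
  , ≡-entries (λ i j → begin
      (mat N *ᴹ M) [ i , j ]           ≡⟨ entries-mat (entries (mat N) ⊡ entries M) i j ⟩
      (entries (mat N) ⊡ entries M) i j ≡⟨ ⊡-congˡ (entries M) (entries-mat N) i j ⟩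
      (N ⊡ entries M) i j              ≡⟨ NM≐δ i j ⟩
      δ i j                            ≡⟨ entries-mat δ i j ⟨
      1ᴹ [ i , j ]                     ∎)
  , ≡-entries (λ i j → begin
      (M *ᴹ mat N) [ i , j ]           ≡⟨ entries-mat (entries M ⊡ entries (mat N)) i j ⟩
      (entries M ⊡ entries (mat N)) i j ≡⟨ ⊡-congʳ (entries M) (entries-mat N) i j ⟩
      (entries M ⊡ N) i j              ≡⟨ ⊡-inverse-comm N (entries M) NM≐δ i j ⟩
      δ i j                            ≡⟨ entries-mat δ i j ⟨
      1ᴹ [ i , j ]                     ∎)
  where open ≡-Reasoning

-- For inner dimension `n` the factor `R` is square, so its right inverse `H ⊡ L` is also a left
-- inverse, and `(H ⊡ L) ⊡ R` is `H ⊡ entries M`.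
factored-invertible : ∀ {M : Mat n} {k} → k ≡ n → (F : Factorisation M k) (H : Matrix n n) →
  Factorisation.right F ⊡ H ⊡ Factorisation.left F ≐ δ → IsInvertible M
factored-invertible {n} {M} refl (factorisation L R M≐LR) H RHL≐δ = invertible M H (begin
  H ⊡ entries M    ≈⟨ ⊡-congʳ H M≐LR ⟩
  H ⊡ L ⊡ R        ≈⟨ ⊡-assoc H L R ⟨
  (H ⊡ L) ⊡ R      ≈⟨ ⊡-inverse-comm R (H ⊡ L) RHL≐δ ⟩
  δ                ∎)
  where open ≈-Reasoning (matrixSetoid n n)

-- Counting

-- `countRank j A` is the instance where `f` sends `t` to `rank (A t)` and the list is `allFin r`.
count : {X : Set} → (X → ℕ) → ℕ → List X → ℕ
count f j xs = length (filter (λ x → f x ℕ.≟ j) xs)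

OneToThree : ℕ → Set
OneToThree k = k ≡ 1 ⊎ k ≡ 2 ⊎ k ≡ 3

count-length : {X : Set} (f : X → ℕ) {xs : List X} → All (OneToThree ∘ f) xs →
               length xs ≡ count f 1 xs ℕ.+ (count f 2 xs ℕ.+ count f 3 xs)
count-length f [] = refl
count-length f (inj₁ fx≡1 ∷ all) rewrite fx≡1 = cong suc (count-length f all)
count-length f {x ∷ xs} (inj₂ (inj₁ fx≡2) ∷ all) rewrite fx≡2 =
  trans (cong suc (count-length f all)) (sym (ℕ.+-suc (count f 1 xs) _))
count-length f {x ∷ xs} (inj₂ (inj₂ fx≡3) ∷ all) rewrite fx≡3 =
  trans (cong suc (count-length f all))
        (trans (sym (ℕ.+-suc (count f 1 xs) _))
               (cong (count f 1 xs ℕ.+_) (sym (ℕ.+-suc (count f 2 xs) _))))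

-- The total is split so that count-length accounts for the first summand.
count-sum : {X : Set} (f : X → ℕ) {xs : List X} → All (OneToThree ∘ f) xs →
            ListAction.sum (map f xs) ≡ length xs ℕ.+ (count f 2 xs ℕ.+ 2 ℕ.* count f 3 xs)
count-sum f [] = refl
count-sum f (inj₁ fx≡1 ∷ all) rewrite fx≡1 = cong suc (count-sum f all)
count-sum f {x ∷ xs} (inj₂ (inj₁ fx≡2) ∷ all) rewrite fx≡2 =
  cong suc (trans (cong suc (count-sum f all)) (sym (ℕ.+-suc (length xs) _)))
count-sum f {x ∷ xs} (inj₂ (inj₂ fx≡3) ∷ all) rewrite fx≡3 | count-sum f all =
  solve 3 (λ l c d → con 3 :+ (l :+ (c :+ con 2 :* d)) :=
                     con 1 :+ l :+ (c :+ con 2 :* (con 1 :+ d)))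
        refl (length xs) (count f 2 xs) (count f 3 xs)
  where open +-*-Solver

sum-tabulate : (f : Vector ℕ n) → ListAction.sum (tabulate f) ≡ sumℕ f
sum-tabulate {zero}  f = refl
sum-tabulate {suc n} f = cong (f zero ℕ.+_) (sum-tabulate (f ∘ suc))

unique-subsingleton : {X : Set} {P : X → Set} → (∀ {x y} → P x → P y → x ≡ y) →
                      {xs : List X} → Unique xs → All P xs → length xs ≤ 1
unique-subsingleton P-prop {[]}     _ _ = z≤n
unique-subsingleton P-prop {_ ∷ []} _ _ = s≤s z≤n
unique-subsingleton P-prop {_ ∷ _ ∷ _} ((x≢y ∷ _) ∷ _) (px ∷ py ∷ _) =
  contradiction (P-prop px py) x≢y

oneToThree : ∀ {k} → k ≢ 0 → k ≤ 3 → OneToThree k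
oneToThree {0} k≢0 _ = contradiction refl k≢0
oneToThree {1} _ _ = inj₁ refl
oneToThree {2} _ _ = inj₂ (inj₁ refl)
oneToThree {3} _ _ = inj₂ (inj₂ refl)
oneToThree {suc (suc (suc (suc _)))} _ (s≤s (s≤s (s≤s ())))

-- The second equation gives 5 = `b` + 2`c`, so `c` = 0 forces `b` = 5 and `c` = 1 forces `b` = 3;
-- the first equation then gives `a`.
solve-profile : ∀ a b c → c ≤ 1 → 22 ≡ a ℕ.+ (b ℕ.+ c) → 27 ≡ 22 ℕ.+ (b ℕ.+ 2 ℕ.* c) →
                (a , b , c) ≡ (17 , 5 , 0) ⊎ (a , b , c) ≡ (18 , 3 , 1)
solve-profile a b 0 _ count≡ sum≡
  with refl ← trans (ℕ.+-cancelˡ-≡ 22 5 _ sum≡) (ℕ.+-identityʳ b)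
  with refl ← ℕ.+-cancelʳ-≡ 5 17 a count≡ = inj₁ refl
solve-profile a b 1 _ count≡ sum≡
  with refl ← ℕ.+-cancelʳ-≡ 2 3 b (ℕ.+-cancelˡ-≡ 22 5 _ sum≡)
  with refl ← ℕ.+-cancelʳ-≡ 4 18 a count≡ = inj₂ refl
solve-profile a b (suc (suc _)) (s≤s ()) _ _

-- The length stays a variable, so that allFin r is not unfolded.
count-profile : r ≡ 22 → (f : Vector ℕ r) → sumℕ f ≡ 27 → (∀ t → OneToThree (f t)) →
  let xs = allFin r; p = count f 1 xs , count f 2 xs , count f 3 xs in
  count f 3 xs ≤ 1 → p ≡ (17 , 5 , 0) ⊎ p ≡ (18 , 3 , 1)
count-profile {r} r≡22 f sum≡27 oneToThree-f count-3≤1 =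
  solve-profile (count f 1 xs) (count f 2 xs) (count f 3 xs) count-3≤1
    (trans (sym length≡22) (count-length f all))
    (trans (sym total) (trans (count-sum f all)
      (cong (ℕ._+ (count f 2 xs ℕ.+ 2 ℕ.* count f 3 xs)) length≡22)))
  where
  xs = allFin r
  all : All (OneToThree ∘ f) xs
  all = All.universal oneToThree-f xs
  length≡22 : length xs ≡ 22
  length≡22 = trans (length-tabulate id) r≡22
  total : ListAction.sum (map f xs) ≡ 27
  total = trans (cong ListAction.sum (map-tabulate id f)) (trans (sum-tabulate f) sum≡27)

-- Saturated decompositions

-- The inner dimensions are a variable vector, which keeps the enumeration behind `rank` out of the
-- computations.
module FactoredDecomposition {r} (A B C : Vector V r) (decomposition : IsDecomposition A B C)
  (ranks : Vector ℕ r) (F : ∀ t → Factorisation (A t) (ranks t)) (saturated : sumℕ ranks ≡ 27)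
  where

  open ≡-Reasoning

  L : ∀ t → Matrix 3 (ranks t)
  L t = Factorisation.left (F t)

  R : ∀ t → Matrix (ranks t) 3
  R t = Factorisation.right (F t)

  A≐LR : ∀ t → entries (A t) ≐ L t ⊡ R t
  A≐LR t = Factorisation.factors (F t)

  G : ∀ s t → Matrix 3 3
  G s t = entries (B s) ⊡ entries (C t) ᵀ

  x-term : Cell → Index ranks → 𝔽₂
  x-term (i , j , k) (t , a) = L t i a * B t [ j , k ]

  y-term : Index ranks → Cell → 𝔽₂
  y-term (t , a) (i , j , k) = R t a j * C t [ i , k ]

  X : Matrix 27 (sumℕ ranks)
  X x p = x-term (cell x) (split ranks p)

  Y : Matrix (sumℕ ranks) 27
  Y p x = y-term (split ranks p) (cell x)

  interchange : ∀ l b r c → (l * b) * (r * c) ≡ (l * r) * (b * c)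
  interchange l b r c = begin
    (l * b) * (r * c)  ≡⟨ *-assoc l b (r * c) ⟩
    l * (b * (r * c))
      ≡⟨ cong (l *_) (trans (sym (*-assoc b r c))
                   (trans (cong (_* c) (*-comm b r)) (*-assoc r b c))) ⟩
    l * (r * (b * c))  ≡⟨ sym (*-assoc l r (b * c)) ⟩
    (l * r) * (b * c)  ∎

  -- Summing over `a` reassembles `A t` from its factors; summing over `t` then gives a coordinate
  -- of the decomposed tensor.
  X⊡Y≐δ : X ⊡ Y ≐ δ
  X⊡Y≐δ x y = let i , j , k = cell x ; i′ , j′ , k′ = cell y in begin
    (X ⊡ Y) x y
      ≡⟨ sum-split ranks (λ q → x-term (cell x) q * y-term q (cell y)) ⟩
    sum (λ t → sum λ a → (L t i a * B t [ j , k ]) * (R t a j′ * C t [ i′ , k′ ]))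
      ≡⟨ sum-cong₂ (λ t a → interchange (L t i a) (B t [ j , k ]) (R t a j′) (C t [ i′ , k′ ])) ⟩
    sum (λ t → sum λ a → (L t i a * R t a j′) * (B t [ j , k ] * C t [ i′ , k′ ]))
      ≡⟨ sum-cong-≗ (λ t → *-distribʳ-sum (B t [ j , k ] * C t [ i′ , k′ ])
                                           (λ a → L t i a * R t a j′)) ⟨
    sum (λ t → (L t ⊡ R t) i j′ * (B t [ j , k ] * C t [ i′ , k′ ]))
      ≡⟨ sum-cong-≗ (λ t → trans (cong (_* (B t [ j , k ] * C t [ i′ , k′ ])) (sym (A≐LR t i j′)))
                                 (sym (*-assoc (A t [ i , j′ ]) (B t [ j , k ]) (C t [ i′ , k′ ])))) ⟩
    sumᵀ (λ t → A t ⊗ B t ⊗ C t) i j′ j k i′ k′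
      ≡⟨ decomposition i j′ j k i′ k′ ⟨
    flatten T⟨3,3,3⟩ x y
      ≡⟨ flatten-T⟨3,3,3⟩ x y ⟩
    δ x y ∎

  Y⊡X≐δ : Y ⊡ X ≐ δ
  Y⊡X≐δ = ⊡-inverse-comm-≡ (sym saturated) X Y X⊡Y≐δ

  -- This is the block of `Y ⊡ X` with rows from `t` and columns from `s`. In the sum over cells,
  -- `k` contracts `B s` with `C t` to `G s t`, while `j` and `i` contract it with `R t` and `L s`.
  gram : ∀ s t (a : Fin (ranks t)) (b : Fin (ranks s)) →
         (R t ⊡ G s t ⊡ L s) a b ≡ δ (merge ranks t a) (merge ranks s b)
  gram s t a b = begin
    sum (λ j → R t a j * sum λ i → G s t j i * L s i b)
      ≡⟨ sum-cong-≗ (λ j → trans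
           (*-distribˡ-sum (R t a j) (λ i → G s t j i * L s i b))
           (sum-cong-≗ λ i → trans
             (cong (R t a j *_) (*-distribʳ-sum (L s i b) λ k → B s [ j , k ] * C t [ i , k ]))
             (*-distribˡ-sum (R t a j) λ k → (B s [ j , k ] * C t [ i , k ]) * L s i b))) ⟩
    sum (λ j → sum λ i → sum λ k → R t a j * ((B s [ j , k ] * C t [ i , k ]) * L s i b))
      -- The cell order puts `i` before `j`, the matrix product `j` before `i`.
      ≡⟨ ∑-comm (λ j i → sum λ k → R t a j * ((B s [ j , k ] * C t [ i , k ]) * L s i b)) ⟩
    sum (λ i → sum λ j → sum λ k → R t a j * ((B s [ j , k ] * C t [ i , k ]) * L s i b))
      ≡⟨ sum-cong₂ (λ i j → sum-cong-≗ λ k →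
           reorder (R t a j) (B s [ j , k ]) (C t [ i , k ]) (L s i b)) ⟩
    sum (λ i → sum λ j → sum λ k → y-term (t , a) (i , j , k) * x-term (i , j , k) (s , b))
      ≡⟨ sum-cell (λ c → y-term (t , a) c * x-term c (s , b)) ⟨
    sum (λ x → y-term (t , a) (cell x) * x-term (cell x) (s , b))
      ≡⟨ sum-cong-≗ (λ x → cong₂ (λ p q → y-term p (cell x) * x-term (cell x) q)
                                 (split-merge ranks t a) (split-merge ranks s b)) ⟨
    (Y ⊡ X) (merge ranks t a) (merge ranks s b)
      ≡⟨ Y⊡X≐δ (merge ranks t a) (merge ranks s b) ⟩
    δ (merge ranks t a) (merge ranks s b) ∎
    where
    reorder : ∀ r b c l → r * ((b * c) * l) ≡ (r * c) * (l * b)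
    reorder r b c l = begin
      r * ((b * c) * l)  ≡⟨ cong (λ z → r * (z * l)) (*-comm b c) ⟩
      r * ((c * b) * l)  ≡⟨ cong (r *_) (*-assoc c b l) ⟩
      r * (c * (b * l))  ≡⟨ *-assoc r c (b * l) ⟨
      (r * c) * (b * l)  ≡⟨ cong ((r * c) *_) (*-comm b l) ⟩
      (r * c) * (l * b)  ∎

  gram-diagonal : ∀ t → R t ⊡ G t t ⊡ L t ≐ δ
  gram-diagonal t a b = trans (gram t t a b)
    (δ-injective (λ eq → inj (merge-injective ranks t t eq)) a b)
    where
    inj : ∀ {a b} → _≡_ {A = Index ranks} (t , a) (t , b) → a ≡ b
    inj refl = refl

  gram-offDiagonal : ∀ {s t} → s ≢ t → R t ⊡ G s t ⊡ L s ≐ 𝟘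
  gram-offDiagonal {s} {t} s≢t a b = trans (gram s t a b)
    (δ-distinct λ eq → s≢t (sym (cong proj₁ (merge-injective ranks t s eq))))

  -- Multiplying the block by `L t` and `R s` turns statements about the factors, whose sizes vary,
  -- into statements about 3 × 3 matrices.
  sandwich : ∀ s t → entries (A t) ⊡ G s t ⊡ entries (A s) ≐ L t ⊡ (R t ⊡ G s t ⊡ L s) ⊡ R s
  sandwich s t = begin′
    entries (A t) ⊡ G s t ⊡ entries (A s)
      ≈⟨ ⊡-congˡ (G s t ⊡ entries (A s)) (A≐LR t) ⟩
    (L t ⊡ R t) ⊡ G s t ⊡ entries (A s)
      ≈⟨ ⊡-congʳ (L t ⊡ R t) (⊡-congʳ (G s t) (A≐LR s)) ⟩
    (L t ⊡ R t) ⊡ G s t ⊡ L s ⊡ R s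
      ≈⟨ ⊡-assoc (L t) (R t) (G s t ⊡ L s ⊡ R s) ⟩
    L t ⊡ R t ⊡ G s t ⊡ L s ⊡ R s
      ≈⟨ ⊡-congʳ (L t) (⊡-congʳ (R t) (⊡-assoc (G s t) (L s) (R s))) ⟨
    L t ⊡ R t ⊡ (G s t ⊡ L s) ⊡ R s
      ≈⟨ ⊡-congʳ (L t) (⊡-assoc (R t) (G s t ⊡ L s) (R s)) ⟨
    L t ⊡ (R t ⊡ G s t ⊡ L s) ⊡ R s ∎′
    where open ≈-Reasoning (matrixSetoid 3 3) renaming (begin_ to begin′_; _∎ to _∎′)

  -- Thus `G t t` is a generalised inverse of `A t`, and a true inverse once `A t` can be cancelled.
  sandwich-diagonal : ∀ t → entries (A t) ⊡ G t t ⊡ entries (A t) ≐ entries (A t)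
  sandwich-diagonal t = begin′
    entries (A t) ⊡ G t t ⊡ entries (A t)  ≈⟨ sandwich t t ⟩
    L t ⊡ (R t ⊡ G t t ⊡ L t) ⊡ R t        ≈⟨ ⊡-congʳ (L t) (⊡-congˡ (R t) (gram-diagonal t)) ⟩
    L t ⊡ δ ⊡ R t                          ≈⟨ ⊡-congʳ (L t) (⊡-identityˡ (R t)) ⟩
    L t ⊡ R t                              ≈⟨ A≐LR t ⟨
    entries (A t)                          ∎′
    where open ≈-Reasoning (matrixSetoid 3 3) renaming (begin_ to begin′_; _∎ to _∎′)

  sandwich-offDiagonal : ∀ {s t} → s ≢ t → entries (A t) ⊡ G s t ⊡ entries (A s) ≐ 𝟘
  sandwich-offDiagonal {s} {t} s≢t = begin′
    entries (A t) ⊡ G s t ⊡ entries (A s)  ≈⟨ sandwich s t ⟩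
    L t ⊡ (R t ⊡ G s t ⊡ L s) ⊡ R s        ≈⟨ ⊡-congʳ (L t) (⊡-congˡ (R s) (gram-offDiagonal s≢t)) ⟩
    L t ⊡ 𝟘 ⊡ R s                          ≈⟨ ⊡-congʳ (L t) (⊡-zeroˡ (R s)) ⟩
    L t ⊡ 𝟘                                ≈⟨ ⊡-zeroʳ (L t) ⟩
    𝟘                                      ∎′
    where open ≈-Reasoning (matrixSetoid 3 3) renaming (begin_ to begin′_; _∎ to _∎′)

  G⊡A≐δ : ∀ {t} → IsInvertible (A t) → G t t ⊡ entries (A t) ≐ δ
  G⊡A≐δ {t} A⁻¹ = ⊡-cancelˡ (entries (proj₁ A⁻¹)) (entries (A t)) (G t t ⊡ entries (A t)) δ
    (entries-inverseˡ {M = A t} A⁻¹)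
    λ i j → trans (sandwich-diagonal t i j) (sym (⊡-identityʳ (entries (A t)) i j))

  -- Cancelling both invertible factors in `sandwich-offDiagonal` leaves `Bₛ ⊡ Cₜᵀ ≐ 𝟘`. Since `Bₛ`
  -- has a left inverse, `Cₜᵀ` vanishes, hence so does `G t t`, although `G t t` inverts `A t`.
  ¬distinct-invertible : ∀ {s t} → s ≢ t → IsInvertible (A s) → ¬ IsInvertible (A t)
  ¬distinct-invertible {s} {t} s≢t Aₛ⁻¹ Aₜ⁻¹ =
    -- The product would be both `δ` and `𝟘`; these differ at the entry (0, 0).
    contradiction (trans (sym (G⊡A≐δ Aₜ⁻¹ zero zero)) (GₜAₜ≐𝟘 zero zero)) λ ()
    where
    Bₛ = entries (B s)
    Bₜ = entries (B t)
    Cₛᵀ = entries (C s) ᵀ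
    Cₜᵀ = entries (C t) ᵀ
    Aₛ = entries (A s)
    Aₜ = entries (A t)

    GAₛ≐𝟘 : G s t ⊡ Aₛ ≐ 𝟘
    GAₛ≐𝟘 = ⊡-cancelˡ (entries (proj₁ Aₜ⁻¹)) Aₜ (G s t ⊡ Aₛ) 𝟘 (entries-inverseˡ {M = A t} Aₜ⁻¹)
      λ i j → trans (sandwich-offDiagonal s≢t i j) (sym (⊡-zeroʳ Aₜ i j))

    BₛCₜᵀ≐𝟘 : Bₛ ⊡ Cₜᵀ ≐ 𝟘
    BₛCₜᵀ≐𝟘 = ⊡-cancelʳ (entries (proj₁ Aₛ⁻¹)) Aₛ (G s t) 𝟘 (entries-inverseʳ {M = A s} Aₛ⁻¹)
      λ i j → trans (GAₛ≐𝟘 i j) (sym (⊡-zeroˡ Aₛ i j))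

    -- Commuting one-sided inverses twice rotates the product equal to `δ` cyclically: B Cᵀ A, then
    -- A B Cᵀ, then Cᵀ A B. The last form exhibits a left inverse of `Bₛ`.
    CₛᵀAₛBₛ≐δ : (Cₛᵀ ⊡ Aₛ) ⊡ Bₛ ≐ δ
    CₛᵀAₛBₛ≐δ i j = trans (⊡-assoc Cₛᵀ Aₛ Bₛ i j)
      (⊡-inverse-comm (Aₛ ⊡ Bₛ) Cₛᵀ
        (λ i j → trans (⊡-assoc Aₛ Bₛ Cₛᵀ i j)
                       (⊡-inverse-comm (Bₛ ⊡ Cₛᵀ) Aₛ (G⊡A≐δ Aₛ⁻¹) i j)) i j)

    Cₜᵀ≐𝟘 : Cₜᵀ ≐ 𝟘
    Cₜᵀ≐𝟘 = ⊡-cancelˡ (Cₛᵀ ⊡ Aₛ) Bₛ Cₜᵀ 𝟘 CₛᵀAₛBₛ≐δ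
      λ i j → trans (BₛCₜᵀ≐𝟘 i j) (sym (⊡-zeroʳ Bₛ i j))

    GₜAₜ≐𝟘 : G t t ⊡ Aₜ ≐ 𝟘
    GₜAₜ≐𝟘 i j = trans
      (⊡-congˡ Aₜ (λ i j → trans (⊡-congʳ Bₜ Cₜᵀ≐𝟘 i j) (⊡-zeroʳ Bₜ i j)) i j)
      (⊡-zeroˡ Aₜ i j)

  full-rank⇒invertible : ∀ {t} → ranks t ≡ 3 → IsInvertible (A t)
  full-rank⇒invertible {t} full = factored-invertible full (F t) (G t t) (gram-diagonal t)

  invertible-unique : ∀ s t → IsInvertible (A s) → IsInvertible (A t) → s ≡ t
  invertible-unique s t Aₛ⁻¹ Aₜ⁻¹ with s Fin.≟ t
  ... | yes s≡t = s≡t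
  ... | no  s≢t = contradiction Aₜ⁻¹ (¬distinct-invertible s≢t Aₛ⁻¹)

  -- The filtered list has distinct entries, all of them indices of invertible factors, and any two
  -- such indices agree.
  count-3≤1 : count ranks 3 (allFin r) ≤ 1
  count-3≤1 = unique-subsingleton
    (λ {s} {t} full-s full-t →
      invertible-unique s t (full-rank⇒invertible full-s) (full-rank⇒invertible full-t))
    (Unique.filter⁺ (λ t → ranks t ℕ.≟ 3) (Unique.allFin⁺ r))
    (All.all-filter (λ t → ranks t ℕ.≟ 3) (allFin r))

saturated⇒invertible-unique : (A B C : Vector V r) → IsDecomposition A B C → Saturated A →
  ∀ s t → IsInvertible (A s) → IsInvertible (A t) → s ≡ t
saturated⇒invertible-unique A B C decomposition saturated =
  FactoredDecomposition.invertible-unique A B C decomposition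
    (λ t → rank (A t)) (λ t → rank-factorisation (A t)) saturated

nonzero⇒profile : (A B C : Vector V r) → IsDecomposition A B C → Saturated A →
  r ≡ 22 → (∀ t → A t ≢ 0ᴹ) → profile A ≡ (17 , 5 , 0) ⊎ profile A ≡ (18 , 3 , 1)
nonzero⇒profile A B C decomposition saturated r≡22 A≢0 =
  count-profile r≡22 (λ t → rank (A t)) saturated
    (λ t → oneToThree (A≢0 t ∘ rank≡0⇒≡0ᴹ (A t)) (rank≤n (A t)))
    (FactoredDecomposition.count-3≤1 A B C decomposition
      (λ t → rank (A t)) (λ t → rank-factorisation (A t)) saturated)

-- Deleting a term with zero first factor.

sum-removeAt : (f : Vector 𝔽₂ (suc n)) (t : Fin (suc n)) → f t ≡ 0# → sum (removeAt f t) ≡ sum f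
sum-removeAt f t ft≡0 = trans (cong (_+ sum (removeAt f t)) (sym ft≡0)) (sym (sum-remove {i = t} f))

removeAt-decomposition : (A B C : Vector V (suc r)) (t : Fin (suc r)) → A t ≡ 0ᴹ →
  IsDecomposition A B C → IsDecomposition (removeAt A t) (removeAt B t) (removeAt C t)
removeAt-decomposition A B C t Aₜ≡0 decomposition i j k l m n =
  trans (decomposition i j k l m n) (sym (sum-removeAt
    (λ s → (A s ⊗ B s ⊗ C s) i j k l m n) t
    (cong (λ a → a * B t [ k , l ] * C t [ m , n ])
          (trans (cong (_[ i , j ]) Aₜ≡0) (entries-mat 𝟘 i j)))))

-- The enumeration over the eight sets of columns is evaluated.
rank-0ᴹ : rank {3} 0ᴹ ≡ 0
rank-0ᴹ = refl

sumℕ-removeAt : (f : Vector ℕ (suc n)) (t : Fin (suc n)) → f t ≡ 0 → sumℕ (removeAt f t) ≡ sumℕ f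
sumℕ-removeAt f t ft≡0 =
  trans (cong (ℕ._+ sumℕ (removeAt f t)) (sym ft≡0)) (sym (ℕSum.sum-remove {i = t} f))

removeAt-saturated : (A : Vector V (suc r)) (t : Fin (suc r)) → A t ≡ 0ᴹ →
                     Saturated A → Saturated (removeAt A t)
removeAt-saturated A t Aₜ≡0 saturated =
  trans (sumℕ-removeAt (λ s → rank (A s)) t (trans (cong rank Aₜ≡0) rank-0ᴹ)) saturated

-- The decision is an argument because matching on it with a with-abstraction
-- would normalise every rank in the goal.
profile-or-shorter : (A B C : Vector V (suc r)) → IsDecomposition A B C → Saturated A →
  suc r ≡ 22 → Dec (∃ λ t → A t ≡ 0ᴹ) →
  (profile A ≡ (17 , 5 , 0) ⊎ profile A ≡ (18 , 3 , 1))
  ⊎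
  (∃ λ t → A t ≡ 0ᴹ
  × IsDecomposition (removeAt A t) (removeAt B t) (removeAt C t)
  × Saturated (removeAt A t))
profile-or-shorter A B C dec sat _ (yes (t , Aₜ≡0)) =
  inj₂ (t , Aₜ≡0 , removeAt-decomposition A B C t Aₜ≡0 dec , removeAt-saturated A t Aₜ≡0 sat)
profile-or-shorter A B C dec sat r≡22 (no ¬zero) =
  inj₁ (nonzero⇒profile A B C dec sat r≡22 λ t Aₜ≡0 → ¬zero (t , Aₜ≡0))

zero-factor? : (A : Vector V r) → Dec (∃ λ t → A t ≡ 0ᴹ)
zero-factor? A = Fin.any? λ t → Vec.≡-dec (Vec.≡-dec Bool._≟_) (A t) 0ᴹ

corollary6p1 : ((r : ℕ) (A B C : Vector V r) → IsDecomposition A B C → Saturated A →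
    (s t : Fin r) → IsInvertible (A s) → IsInvertible (A t) → s ≡ t)
    ×
    ((A B C : Vector V 22) → IsDecomposition A B C → Saturated A →
    (∀ t → A t ≢ 0ᴹ) →
    profile A ≡ (17 , 5 , 0) ⊎ profile A ≡ (18 , 3 , 1))
    ×
    ((A B C : Vector V 22) → IsDecomposition A B C → Saturated A →
    (profile A ≡ (17 , 5 , 0) ⊎ profile A ≡ (18 , 3 , 1))
    ⊎
    (∃ λ (t : Fin 22) → A t ≡ 0ᴹ
    × IsDecomposition (removeAt A t) (removeAt B t) (removeAt C t)
    × Saturated (removeAt A t)))
corollary6p1 =
    (λ r → saturated⇒invertible-unique)
  , (λ A B C dec sat → nonzero⇒profile A B C dec sat refl)
  -- The alternative is settled by deciding whether some first factor is zero.
  , (λ A B C dec sat → profile-or-shorter A B C dec sat refl (zero-factor? A))
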